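{- There are absolute constants $c>0$ and $T_0$ such that for every $N\ge2$, every $T\ge T_0$ and every online deterministic algorithm $\mathcal{A}$ for the limited-feedback model described in the context, there is a sequence of loads $L_1,\dots,L_T\in\mathbb{R}_{\ge0}^N$ with $$\mathrm{work}_{h_1^*,\dots,h_T^*}-\mathrm{work}_{\mathcal{A}}\ \ge\ c\sqrt{T},$$ i.e. $\mathrm{work}_{h_1^*,\dots,h_T^*}-\mathrm{work}_{\mathcal{A}}=\Omega(\sqrt T)$, where $h_1^*,\dots,h_T^*$ are optimal offline dynamic allocations, i.e. allocations maximizing the total work on the loads $L_1,\dots,L_T$ among all sequences in $[0,1]^N$ with $\sum_i h_t(i)\le1$ for every $t$.
   Context: Model. There are $N\ge 2$ users sharing one resource of capacity $1$ over discrete times $t=1,\dots,T$. At time $t$ a load $L_t(i)\ge 0$ arrives for user $i$. Given allocations $h_1,\dots,h_T\in[0,1]^N$ with $\sum_i h_t(i)\le 1$, the work and the queues are defined by $Q_1(i)=0$ and $$w_t(i)=\min\{h_t(i),\,L_t(i)+Q_t(i)\},\qquad Q_{t+1}(i)=\max\{0,\,L_t(i)+Q_t(i)-h_t(i)\}.$$ The total work of the allocations is $\sum_{t=1}^T\sum_{i=1}^N w_t(i)$, written $\mathrm{work}_{h_1,\dots,h_T}$; $\mathrm{work}_{\mathcal{A}}$ is the total work of the allocations chosen by $\mathcal{A}$. Online deterministic algorithm with limited feedback. At time $t$, before the load $L_t$ arrives, the algorithm observes only the set $A_t=\{i:Q_t(i)>0\}$ of users with non-empty queue (not the queue lengths nor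 the loads), and then chooses $h_t$; thus $h_t$ is a deterministic function of $A_1,\dots,A_t$ (and of fixed data such as $N$, $T$ and the SLAs). -}

module Defs where

open import Algebra.Bundles using (CommutativeRing)
import Algebra.Construct.NaturalChoice.Max as Max
import Algebra.Construct.NaturalChoice.Min as Min
import Algebra.Definitions.RawMonoid as RawMonoidDefinitions
import Algebra.Properties.Ring as RingProperties
import Algebra.Solver.Ring.NaturalCoefficients.Default as SemiringSolver
open import Data.Fin.Base using (Fin; toℕ)
open import Data.Fin.Subset using (Subset)
open import Data.Nat.Base as ℕ using (ℕ; zero; suc)
open import Data.Product.Base using (_×_; _,_; proj₁; proj₂; ∃)
open import Data.Sum.Base using (inj₁; inj₂)
open import Data.Vec.Base using (Vec; []; _∷_; tabulate)
open import Data.Vec.Functional using (Vector)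
open import Level using () renaming (_⊔_ to _⊔ˡ_; suc to lsuc)
open import Relation.Binary.Bundles using (DecTotalOrder; StrictTotalOrder)
open import Relation.Binary.Core using (Rel)
open import Relation.Binary.PropositionalEquality.Core using (_≡_; refl; cong)
import Relation.Binary.Properties.DecTotalOrder as DecTotalOrderProperties
open import Relation.Binary.Structures using (IsDecTotalOrder)
open import Relation.Nullary.Decidable.Core using (does; yes; no)
open import Relation.Nullary.Negation.Core using (¬_; contradiction)
open import Relation.Unary using (Pred)

-- The real numbers, given axiomatically as a Dedekind-complete ordered field;
-- classically these axioms determine ℝ up to isomorphism.  Decidability of
-- the order is what excluded middle provides for the classical reals.
record CompleteOrderedField a ℓ₁ ℓ₂ : Set (lsuc (a ⊔ˡ ℓ₁ ⊔ˡ ℓ₂)) where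
  infix 4 _≤_
  field
    commutativeRing : CommutativeRing a ℓ₁

  open CommutativeRing commutativeRing public hiding (zero)
    renaming (refl to ≈-refl; reflexive to ≈-reflexive; sym to ≈-sym; trans to ≈-trans)

  field
    0≉1             : ¬ 0# ≈ 1#
    inverse         : ∀ x → ¬ x ≈ 0# → ∃ λ y → x * y ≈ 1#
    _≤_             : Rel Carrier ℓ₂
    isDecTotalOrder : IsDecTotalOrder _≈_ _≤_
    +-monoʳ-≤       : ∀ z {x y} → x ≤ y → z + x ≤ z + y
    *-nonNegative   : ∀ {x y} → 0# ≤ x → 0# ≤ y → 0# ≤ x * y

  IsUpperBound : Pred Carrier ℓ₂ → Pred Carrier (a ⊔ˡ ℓ₂)
  IsUpperBound P b = ∀ y → P y → y ≤ b

  field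
    supremum : ∀ (P : Pred Carrier ℓ₂) → ∃ P → ∃ (IsUpperBound P) →
               ∃ λ s → IsUpperBound P s × (∀ b → IsUpperBound P b → s ≤ b)

  decTotalOrder : DecTotalOrder a ℓ₁ ℓ₂
  decTotalOrder = record { isDecTotalOrder = isDecTotalOrder }

  open DecTotalOrder decTotalOrder public
    using (_≤?_; _≟_; total; antisym; totalOrder; ≤-respʳ-≈; ≤-respˡ-≈)
    renaming (refl to ≤-refl; reflexive to ≤-reflexive; trans to ≤-trans)
  open DecTotalOrderProperties decTotalOrder public
    using (_<_; <-strictTotalOrder; ≰⇒>; <⇒≱)
  open StrictTotalOrder <-strictTotalOrder public using (_<?_)
  open Min totalOrder public using (_⊓_)
  open Max totalOrder public using (_⊔_)
  open RawMonoidDefinitions +-rawMonoid public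
    using (sum) renaming (_×_ to _·_)

  fromℕ : ℕ → Carrier
  fromℕ n = n · 1#

module SquareRoot {a ℓ₁ ℓ₂} (ℝ : CompleteOrderedField a ℓ₁ ℓ₂) where
  open CompleteOrderedField ℝ
  open RingProperties ring using (-‿distribˡ-*; -‿involutive)
  open SemiringSolver commutativeSemiring

  +-mono-≤ : ∀ {w x y z} → w ≤ x → y ≤ z → w + y ≤ x + z
  +-mono-≤ {w} {x} {y} {z} w≤x y≤z = ≤-trans (+-monoʳ-≤ w y≤z)
    (≤-respˡ-≈ (+-comm z w) (≤-respʳ-≈ (+-comm z x) (+-monoʳ-≤ z w≤x)))

  x≤x+y : ∀ {x y} → 0# ≤ y → x ≤ x + y
  x≤x+y {x} 0≤y = ≤-respˡ-≈ (+-identityʳ x) (+-monoʳ-≤ x 0≤y)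

  +-nonNegative : ∀ {x y} → 0# ≤ x → 0# ≤ y → 0# ≤ x + y
  +-nonNegative 0≤x 0≤y = ≤-trans 0≤x (x≤x+y 0≤y)

  difference : ∀ {x y} → x ≤ y → ∃ λ u → 0# ≤ u × y ≈ x + u
  difference {x} {y} x≤y = - x + y
    , ≤-respˡ-≈ (-‿inverseˡ x) (+-monoʳ-≤ (- x) x≤y)
    , ≈-sym (≈-trans (≈-sym (+-assoc x (- x) y))
        (≈-trans (+-congʳ (-‿inverseʳ x)) (+-identityˡ y)))

  0≤1 : 0# ≤ 1#
  0≤1 with total 0# 1#
  ... | inj₁ p = p
  ... | inj₂ 1≤0 = ≤-respʳ-≈ square (*-nonNegative 0≤-1 0≤-1)
    where
    0≤-1 : 0# ≤ - 1#
    0≤-1 = ≤-respˡ-≈ (-‿inverseˡ 1#) (≤-respʳ-≈ (+-identityʳ (- 1#)) (+-monoʳ-≤ (- 1#) 1≤0))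
    square : - 1# * - 1# ≈ 1#
    square = ≈-trans (≈-sym (-‿distribˡ-* 1# (- 1#)))
      (≈-trans (-‿cong (*-identityˡ (- 1#))) (-‿involutive 1#))

  fromℕ-nonNegative : ∀ n → 0# ≤ fromℕ n
  fromℕ-nonNegative zero    = ≤-refl
  fromℕ-nonNegative (suc n) = +-nonNegative 0≤1 (fromℕ-nonNegative n)

  +-cancelˡ-≤ : ∀ {x y z} → z + x ≤ z + y → x ≤ y
  +-cancelˡ-≤ {x} {y} {z} p = ≤-respˡ-≈ (cancel x) (≤-respʳ-≈ (cancel y) (+-monoʳ-≤ (- z) p))
    where
    cancel : ∀ w → - z + (z + w) ≈ w
    cancel w = ≈-trans (≈-sym (+-assoc _ _ w)) (≈-trans (+-congʳ (-‿inverseˡ z)) (+-identityˡ w))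

  *-monoʳ-≤ : ∀ {x y z} → 0# ≤ z → x ≤ y → x * z ≤ y * z
  *-monoʳ-≤ {x} {y} {z} 0≤z x≤y with difference x≤y
  ... | u , 0≤u , y≈x+u = ≤-respʳ-≈ (≈-sym (≈-trans (*-congʳ y≈x+u) (distribʳ z x u)))
                            (x≤x+y (*-nonNegative 0≤u 0≤z))

  *-cancelʳ-≤ : ∀ {x y z} → 0# < z → x * z ≤ y * z → x ≤ y
  *-cancelʳ-≤ {x} {y} {z} (0≤z , 0≉z) xz≤yz with x ≤? y
  ... | yes x≤y = x≤y
  ... | no x≰y with inverse z (λ z≈0 → 0≉z (≈-sym z≈0))
  ...   | q , zq≈1 = ≤-reflexive (≈-trans (≈-sym (cancel x))
                       (≈-trans (*-congʳ (antisym xz≤yz (*-monoʳ-≤ 0≤z (proj₁ (≰⇒> x≰y)))))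
                         (cancel y)))
    where
    cancel : ∀ w → w * z * q ≈ w
    cancel w = ≈-trans (*-assoc w z q) (≈-trans (*-congˡ zq≈1) (*-identityʳ w))

  <-≤-trans : ∀ {x y z} → x < y → y ≤ z → x < z
  <-≤-trans (x≤y , x≉y) y≤z = ≤-trans x≤y y≤z ,
    λ x≈z → x≉y (antisym x≤y (≤-respʳ-≈ (≈-sym x≈z) y≤z))

  square-cancel-≤ : ∀ {x y} → 0# ≤ y → x * x ≤ y * y → x ≤ y
  square-cancel-≤ {x} {y} 0≤y xx≤yy with x ≤? y
  ... | yes x≤y = x≤y
  ... | no x≰y = *-cancelʳ-≤ {z = x + y}
      (<-≤-trans (0≤x , λ 0≈x → x≰y (≤-respˡ-≈ 0≈x 0≤y)) (x≤x+y 0≤y))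
      (≤-respˡ-≈ (solve 2 (λ x y → x :* x :+ x :* y := x :* (x :+ y)) ≈-refl x y)
        (≤-respʳ-≈ (solve 2 (λ x y → y :* y :+ x :* y := y :* (x :+ y)) ≈-refl x y)
          (+-mono-≤ xx≤yy ≤-refl)))
    where
    0≤x = ≤-trans 0≤y (proj₁ (≰⇒> x≰y))

  rearrangement : ∀ {w x y z} → w ≤ x → y ≤ z → w * z + x * y ≤ x * z + w * y
  rearrangement {w} {x} {y} {z} w≤x y≤z with difference w≤x | difference y≤z
  ... | u , 0≤u , x≈w+u | v , 0≤v , z≈y+v =
    ≤-respʳ-≈ (≈-trans (solve 4 (λ w u y v →
                  (w :* (y :+ v) :+ (w :+ u) :* y) :+ u :* v := (w :+ u) :* (y :+ v) :+ w :* y)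
                  ≈-refl w u y v)
                (≈-sym (+-congʳ (*-cong x≈w+u z≈y+v))))
      (≤-respˡ-≈ (≈-sym (+-cong (*-congˡ z≈y+v) (*-congʳ x≈w+u)))
        (x≤x+y (*-nonNegative 0≤u 0≤v)))

  module _ {x : Carrier} (0≤x : 0# ≤ x) where

    private
      k = 1# + x

      0≤k : 0# ≤ k
      0≤k = +-nonNegative 0≤1 0≤x

      x≤k² : x ≤ k * k
      x≤k² = ≤-respʳ-≈ (solve 1 (λ x → x :+ (con 1 :+ x :+ x :* x) := (con 1 :+ x) :* (con 1 :+ x)) ≈-refl x)
        (x≤x+y (+-nonNegative 0≤k (*-nonNegative 0≤x 0≤x)))

      0∈S : 0# * 0# ≤ x
      0∈S = ≤-respˡ-≈ (≈-sym (zeroˡ 0#)) 0≤x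

      lub = supremum (λ y → y * y ≤ x) (0# , 0∈S)
              (k , λ y yy≤x → square-cancel-≤ 0≤k (≤-trans yy≤x x≤k²))

    -- The supremum of {y | y² ≤ x}; √-square confirms that it squares to x.
    √ : Carrier
    √ = proj₁ lub

    √-nonNegative : 0# ≤ √
    √-nonNegative = proj₁ (proj₂ lub) 0# 0∈S

    private
      s = √

      0<s+k : 0# < s + k
      0<s+k = <-≤-trans (0≤1 , 0≉1)
        (≤-trans (x≤x+y 0≤x) (≤-respˡ-≈ (+-identityˡ k) (+-mono-≤ √-nonNegative ≤-refl)))

      -- y = (s k + x) / (s + k) satisfies y - s = (x - s²) / (s + k) and
      -- y² - x = (s² - x) (k² - x) / (s + k)².
      q = proj₁ (inverse (s + k) (λ e → proj₂ 0<s+k (≈-sym e)))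
      y = (s * k + x) * q

      y[s+k] : y * (s + k) ≈ s * k + x
      y[s+k] = ≈-trans (*-assoc (s * k + x) q (s + k))
        (≈-trans (*-congˡ (≈-trans (*-comm q (s + k)) (proj₂ (inverse (s + k) _))))
          (*-identityʳ _))

      0≤y : 0# ≤ y
      0≤y = *-cancelʳ-≤ 0<s+k (≤-respˡ-≈ (≈-sym (zeroˡ (s + k)))
        (≤-respʳ-≈ (≈-sym y[s+k]) (+-nonNegative (*-nonNegative √-nonNegative 0≤k) 0≤x)))

      0<[s+k]² : 0# < (s + k) * (s + k)
      0<[s+k]² = *-nonNegative (proj₁ 0<s+k) (proj₁ 0<s+k) ,
        λ e → proj₂ 0<s+k (antisym (proj₁ 0<s+k)
          (square-cancel-≤ ≤-refl (≤-reflexive (≈-trans (≈-sym e) (≈-sym (zeroˡ 0#))))))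

      s[s+k] : s * (s + k) ≈ s * k + s * s
      s[s+k] = solve 2 (λ s k → s :* (s :+ k) := s :* k :+ s :* s) ≈-refl s k

      y²[s+k]² : y * y * ((s + k) * (s + k)) ≈ s * s * (k * k) + x * x + (s * k * x + s * k * x)
      y²[s+k]² = ≈-trans (solve 2 (λ y p → y :* y :* (p :* p) := y :* p :* (y :* p)) ≈-refl y (s + k))
        (≈-trans (*-cong y[s+k] y[s+k])
          (solve 3 (λ s k x → (s :* k :+ x) :* (s :* k :+ x) :=
             s :* s :* (k :* k) :+ x :* x :+ (s :* k :* x :+ s :* k :* x)) ≈-refl s k x))

      x[s+k]² : x * ((s + k) * (s + k)) ≈ x * (k * k) + s * s * x + (s * k * x + s * k * x)
      x[s+k]² = solve 3 (λ s k x → x :* ((s :+ k) :* (s :+ k)) :=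
             x :* (k :* k) :+ s :* s :* x :+ (s :* k :* x :+ s :* k :* x)) ≈-refl s k x

      x≤s² : x ≤ s * s
      x≤s² with x ≤? s * s
      ... | yes p = p
      ... | no x≰s² = +-cancelˡ-≤ (≤-respˡ-≈ y[s+k] (≤-respʳ-≈ s[s+k] (*-monoʳ-≤ (proj₁ 0<s+k) y≤s)))
        where
        y²≤x : y * y ≤ x
        y²≤x = *-cancelʳ-≤ 0<[s+k]² (≤-respˡ-≈ (≈-sym y²[s+k]²) (≤-respʳ-≈ (≈-sym x[s+k]²)
          (+-mono-≤ (rearrangement (proj₁ (≰⇒> x≰s²)) x≤k²) ≤-refl)))
        y≤s : y ≤ s
        y≤s = proj₁ (proj₂ lub) y y²≤x

      s²≤x : s * s ≤ x
      s²≤x with s * s ≤? x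
      ... | yes p = p
      ... | no s²≰x = +-cancelˡ-≤ (≤-respʳ-≈ y[s+k] (≤-respˡ-≈ s[s+k] (*-monoʳ-≤ (proj₁ 0<s+k) s≤y)))
        where
        x≤y² : x ≤ y * y
        x≤y² = *-cancelʳ-≤ 0<[s+k]² (≤-respˡ-≈ (≈-sym x[s+k]²) (≤-respʳ-≈ (≈-sym y²[s+k]²)
          (+-mono-≤ (rearrangement (proj₁ (≰⇒> s²≰x)) x≤k²) ≤-refl)))
        s≤y : s ≤ y
        s≤y = proj₂ (proj₂ lub) y λ z zz≤x → square-cancel-≤ 0≤y (≤-trans zz≤x x≤y²)

    √-square : √ * √ ≈ x
    √-square = antisym s²≤x x≤s²

-- Time starts at 0: index t is the (t + 1)-st time step.  Sequences are indexed
-- by all of ℕ, but only the entries at t < T matter for a horizon T.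
module SharedResource {a ℓ₁ ℓ₂} (ℝ : CompleteOrderedField a ℓ₁ ℓ₂) where
  open CompleteOrderedField ℝ public
  open SquareRoot ℝ public using (√; √-nonNegative; √-square; fromℕ-nonNegative)

  √ℕ : ℕ → Carrier
  √ℕ n = √ (fromℕ-nonNegative n)

  module _ {N : ℕ} where

    Feasible : Vector Carrier N → Set ℓ₂
    Feasible h = (∀ i → 0# ≤ h i × h i ≤ 1#) × sum h ≤ 1#

    NonNegative : Vector Carrier N → Set ℓ₂
    NonNegative L = ∀ i → 0# ≤ L i

    served : (h L Q : Vector Carrier N) → Vector Carrier N
    served h L Q i = h i ⊓ (L i + Q i)

    nextQueue : (h L Q : Vector Carrier N) → Vector Carrier N
    nextQueue h L Q i = 0# ⊔ (L i + Q i - h i)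

    queue : (h L : ℕ → Vector Carrier N) → ℕ → Vector Carrier N
    queue h L zero    i = 0#
    queue h L (suc t)   = nextQueue (h t) (L t) (queue h L t)

    work : (h L : ℕ → Vector Carrier N) → ℕ → Vector Carrier N
    work h L t = served (h t) (L t) (queue h L t)

    totalWork : (T : ℕ) (h L : ℕ → Vector Carrier N) → Carrier
    totalWork T h L = sum {T} λ t → sum (work h L (toℕ t))

    FeasibleUpTo : ℕ → (ℕ → Vector Carrier N) → Set ℓ₂
    FeasibleUpTo T h = ∀ t → t ℕ.< T → Feasible (h t)

    IsOptimalOffline : (T : ℕ) (L h* : ℕ → Vector Carrier N) → Set (a ⊔ˡ ℓ₂)
    IsOptimalOffline T L h* =
      FeasibleUpTo T h* × (∀ h → FeasibleUpTo T h → totalWork T h L ≤ totalWork T h* L)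

    nonEmpty : Vector Carrier N → Subset N
    nonEmpty Q = tabulate λ i → does (0# <? Q i)

  -- The argument of allocate is the feedback A_t ∷ … ∷ A_0, most recent first.
  record OnlineAlgorithm (N : ℕ) : Set (a ⊔ˡ ℓ₂) where
    field
      allocate : ∀ {t} → Vec (Subset N) (suc t) → Vector Carrier N
      feasible : ∀ {t} (A : Vec (Subset N) (suc t)) → Feasible (allocate A)

  module Run {N} (𝒜 : OnlineAlgorithm N) (L : ℕ → Vector Carrier N) where
    open OnlineAlgorithm 𝒜

    -- The queues are recomputed here, because the allocation at time t depends
    -- on the queues up to time t; runQueue≡queue shows they are the same.
    runQueue : ℕ → Vector Carrier N
    feedback : ∀ t → Vec (Subset N) (suc t)
    allocations : ℕ → Vector Carrier N

    runQueue zero    i = 0#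
    runQueue (suc t)   = nextQueue (allocations t) (L t) (runQueue t)

    feedback zero    = nonEmpty (runQueue zero) ∷ []
    feedback (suc t) = nonEmpty (runQueue (suc t)) ∷ feedback t

    allocations t = allocate (feedback t)

    runQueue≡queue : ∀ t → runQueue t ≡ queue allocations L t
    runQueue≡queue zero    = refl
    runQueue≡queue (suc t) = cong (nextQueue (allocations t) (L t)) (runQueue≡queue t)

  open Run public using (allocations)

{-# OPTIONS --safe #-}
module Submission where

-- Loads of total 1 per step, given to two users only, can all be served at
-- once by h* = L, so the regret is the algorithm's final backlog.  That backlog
-- never decreases, and it grows by 1/8 whenever the algorithm allocates at most
-- 7/8 to the two users or gives one of them, who then gets no load, 1/8 more than
-- what is in its queue.
-- As long as both queues are non-empty the feedback is constant, so the adversary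
-- can compare two plans: draining the first user down to 1/8, or the second.
-- Each step wasting nothing in either plan brings the two drained queues
-- together at least 1/8 closer to empty; hence backlog m/8 is forced to grow by
-- 1/8 within m + 9 steps, and backlog m/8 is reached within m (m + 9) steps.

open import Defs
import Algebra.Properties.CommutativeMonoid.Sum as CommutativeMonoidSum
import Algebra.Properties.Monoid.Mult as MonoidMult
import Algebra.Properties.Monoid.Sum as MonoidSum
import Algebra.Properties.Semiring.Mult as SemiringMult
import Algebra.Solver.Ring.NaturalCoefficients.Default as SemiringSolver
open import Data.Bool.Base using (Bool; true; false; not)
open import Data.Fin.Base using (Fin; zero; suc; toℕ)
open import Data.Fin.Subset using (Subset)
open import Data.Nat.Base as ℕ using (ℕ; zero; suc; z≤n; s≤s)
import Data.Nat.Properties as ℕₚ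
open import Data.Nat.Solver using (module +-*-Solver)
open import Data.Product.Base using (Σ-syntax; _×_; _,_; proj₁; proj₂; ∃)
open import Data.Sum.Base using (inj₁; inj₂)
open import Data.Vec.Base using (Vec; []; _∷_; tabulate)
open import Data.Vec.Functional using (Vector)
open import Data.Vec.Properties using (tabulate-cong)
open import Level using (Lift; lift) renaming (_⊔_ to _⊔ˡ_)
open import Function.Base using (_∘_)
open import Relation.Binary.PropositionalEquality.Core using (_≡_; refl; sym; subst; cong₂)
  renaming (trans to ≡-trans)
open import Relation.Nullary.Decidable using (dec-true; dec-false; yes; no)
open import Relation.Nullary.Negation.Core using (¬_; contradiction)

module Adversary {a ℓ₁ ℓ₂} (ℝ : CompleteOrderedField a ℓ₁ ℓ₂) where
  open SharedResource ℝ
  open SquareRoot ℝ using (x≤x+y; +-nonNegative; difference; 0≤1;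
    +-cancelˡ-≤; *-monoʳ-≤; *-cancelʳ-≤; <-≤-trans; square-cancel-≤) renaming (+-mono-≤ to infixr 6 _⊞_)
  open SemiringSolver commutativeSemiring
  open MonoidMult +-monoid using (×-homo-+)
  open SemiringMult semiring using (×1-homo-*)

  -- Ordered-field inequalities and truncated subtraction.

  infixr 8 _:·_
  _:·_ : ∀ {k} → ℕ → Polynomial k → Polynomial k
  zero  :· p = con 0
  suc n :· p = p :+ n :· p

  -- A linear inequality follows from a sum w ≤ z of inequalities that accounts
  -- for it, the accounting being a semiring identity.
  linear : ∀ {w x y z} → w ≤ z → y + w ≈ x + z → x ≤ y
  linear {w} {x} {y} {z} w≤z e = +-cancelˡ-≤ {z = w}
    (≤-respʳ-≈ (≈-trans (≈-sym e) (+-comm y w))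
      (≤-respˡ-≈ (+-comm x w) (+-monoʳ-≤ x w≤z)))

  infixl 6 _∸_
  -- Chosen so that `nextQueue h L Q i` unfolds to `(L i + Q i) ∸ h i`.
  _∸_ : Carrier → Carrier → Carrier
  x ∸ y = 0# ⊔ (x - y)

  0≤∸ : ∀ x y → 0# ≤ x ∸ y
  0≤∸ x y with total (x - y) 0#
  ... | inj₁ _ = ≤-refl
  ... | inj₂ p = p

  x-y+y≈x : ∀ x y → x - y + y ≈ x
  x-y+y≈x x y = ≈-trans (+-assoc x (- y) y)
    (≈-trans (+-congˡ (-‿inverseˡ y)) (+-identityʳ x))

  +-monoˡ-≤ : ∀ z {x y} → x ≤ y → x + z ≤ y + z
  +-monoˡ-≤ z x≤y = x≤y ⊞ ≤-refl

  x≤x∸y+y : ∀ x y → x ≤ (x ∸ y) + y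
  x≤x∸y+y x y with total (x - y) 0#
  ... | inj₁ p = ≤-respˡ-≈ (x-y+y≈x x y) (+-monoˡ-≤ y p)
  ... | inj₂ _ = ≤-reflexive (≈-sym (x-y+y≈x x y))

  x∸y+y≤z : ∀ {x y z} → x ≤ z → y ≤ z → (x ∸ y) + y ≤ z
  x∸y+y≤z {x} {y} x≤z y≤z with total (x - y) 0#
  ... | inj₁ _ = ≤-respˡ-≈ (≈-sym (+-identityˡ y)) y≤z
  ... | inj₂ _ = ≤-respˡ-≈ (≈-sym (x-y+y≈x x y)) x≤z

  +-cancelʳ-≤ : ∀ {x y z} → x + z ≤ y + z → x ≤ y
  +-cancelʳ-≤ {x} {y} {z} p = linear p (solve 3 (λ x y z → y :+ (x :+ z) := x :+ (y :+ z)) ≈-refl x y z)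

  x∸y≤z : ∀ {x y z} → 0# ≤ z → x ≤ z + y → x ∸ y ≤ z
  x∸y≤z {x} {y} {z} 0≤z p = +-cancelʳ-≤ (x∸y+y≤z p
    (≤-respˡ-≈ (+-identityˡ y) (+-monoˡ-≤ y 0≤z)))

  -- With `x` the load plus queue of one user, this is conservation of work in one step; `balance`
  -- sums it.
  ⊓+∸ : ∀ h x → h ⊓ x + (x ∸ h) ≈ x
  ⊓+∸ h x with total h x
  ... | inj₁ h≤x = antisym
          (≤-respˡ-≈ (+-comm (x ∸ h) h) (x∸y+y≤z ≤-refl h≤x))
          (≤-respʳ-≈ (+-comm (x ∸ h) h) (x≤x∸y+y x h))
  ... | inj₂ x≤h = ≈-trans (+-congˡ (antisym
          (x∸y≤z ≤-refl (≤-respʳ-≈ (≈-sym (+-identityˡ h)) x≤h)) (0≤∸ x h)))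
          (+-identityʳ x)

  -- Natural multiples and the unit `u` = 1/8.

  fromℕ-mono-≤ : ∀ {m n} → m ℕ.≤ n → fromℕ m ≤ fromℕ n
  fromℕ-mono-≤ {n = n} z≤n = fromℕ-nonNegative n
  fromℕ-mono-≤ (s≤s m≤n)   = +-monoʳ-≤ 1# (fromℕ-mono-≤ m≤n)

  0<1 : 0# < 1#
  0<1 = 0≤1 , 0≉1

  <⇒≉ : ∀ {x y} → x < y → ¬ y ≈ x
  <⇒≉ (_ , x≉y) y≈x = x≉y (≈-sym y≈x)

  0<8 : 0# < fromℕ 8
  0<8 = <-≤-trans 0<1 (x≤x+y (fromℕ-nonNegative 7))

  fromℕ-* : ∀ n x → fromℕ n * x ≈ n · x
  fromℕ-* zero    x = zeroˡ x
  fromℕ-* (suc n) x = ≈-trans (distribʳ x 1# (fromℕ n)) (+-cong (*-identityˡ x) (fromℕ-* n x))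

  abstract
    u : Carrier
    u = proj₁ (inverse (fromℕ 8) (<⇒≉ 0<8))

    8·u≈1 : 8 · u ≈ 1#
    8·u≈1 = ≈-trans (≈-sym (fromℕ-* 8 u)) (proj₂ (inverse (fromℕ 8) (<⇒≉ 0<8)))

  0<u : 0# < u
  0<u = *-cancelʳ-≤ 0<8 (≤-respˡ-≈ (≈-sym (zeroˡ _)) (≤-respʳ-≈ (≈-sym u*8≈1) 0≤1))
      , λ 0≈u → 0≉1 (≈-trans (≈-sym (zeroˡ (fromℕ 8))) (≈-trans (*-congʳ 0≈u) u*8≈1))
    where
    u*8≈1 : u * fromℕ 8 ≈ 1#
    u*8≈1 = ≈-trans (*-comm u (fromℕ 8)) (≈-trans (fromℕ-* 8 u) 8·u≈1)

  0≤u : 0# ≤ u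
  0≤u = proj₁ 0<u

  ·u-nonNegative : ∀ n → 0# ≤ n · u
  ·u-nonNegative zero    = ≤-refl
  ·u-nonNegative (suc n) = +-nonNegative 0≤u (·u-nonNegative n)

  ·u-mono-≤ : ∀ {m n} → m ℕ.≤ n → m · u ≤ n · u
  ·u-mono-≤ {n = n} z≤n = ·u-nonNegative n
  ·u-mono-≤ (s≤s m≤n)   = +-monoʳ-≤ u (·u-mono-≤ m≤n)

  sum-nonNegative : ∀ {n} {x : Vector Carrier n} → (∀ i → 0# ≤ x i) → 0# ≤ sum x
  sum-nonNegative {zero}  _   = ≤-refl
  sum-nonNegative {suc n} 0≤x = +-nonNegative (0≤x zero) (sum-nonNegative (0≤x ∘ suc))

  -- Queues of the two users that receive load.

  module _ {k : ℕ} where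

    Users = Vector Carrier (suc (suc k))

    Admissible : Users → Set ℓ₂
    Admissible L = NonNegative L × sum L ≤ 1#

    user : Bool → Fin (suc (suc k))
    user false = zero
    user true  = suc zero

    backlog : Users → Carrier
    backlog Q = Q zero + Q (suc zero)

    Unused : Users → Set ℓ₁
    Unused Q = ∀ i → Q (suc (suc i)) ≈ 0#

    split : Bool → Carrier → Carrier → Users
    split false x y zero          = x
    split false x y (suc zero)    = y
    split true  x y zero          = y
    split true  x y (suc zero)    = x
    split _     x y (suc (suc _)) = 0#

    backlog-user : ∀ i Q → Q (user i) + Q (user (not i)) ≈ backlog Q
    backlog-user false Q = ≈-refl
    backlog-user true  Q = +-comm _ _

    backlog≤sum : ∀ {Q} → (∀ i → 0# ≤ Q i) → backlog Q ≤ sum Q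
    backlog≤sum {Q} 0≤Q = +-monoʳ-≤ (Q zero) (x≤x+y (sum-nonNegative (λ i → 0≤Q (suc (suc i)))))

    split-admissible : ∀ i {x y} → 0# ≤ x → 0# ≤ y → x + y ≈ 8 · u → Admissible (split i x y)
    split-admissible i {x} {y} 0≤x 0≤y x+y≈8u = nonNegative i
      , ≤-reflexive (≈-trans (sum-split i) (≈-trans x+y≈8u 8·u≈1))
      where
      nonNegative : ∀ i → NonNegative (split i x y)
      nonNegative false zero          = 0≤x
      nonNegative false (suc zero)    = 0≤y
      nonNegative true  zero          = 0≤y
      nonNegative true  (suc zero)    = 0≤x
      nonNegative false (suc (suc _)) = ≤-refl
      nonNegative true  (suc (suc _)) = ≤-refl

      rest : sum {k} (λ _ → 0#) ≈ 0#
      rest = MonoidSum.sum-replicate-zero +-monoid k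

      sum-split : ∀ i → sum (split i x y) ≈ x + y
      sum-split false = +-congˡ (≈-trans (+-congˡ rest) (+-identityʳ y))
      sum-split true  = ≈-trans (+-congˡ (≈-trans (+-congˡ rest) (+-identityʳ x))) (+-comm y x)

    module _ (h Q : Users) where

      nextQueue-split : ∀ i x y →
        nextQueue h (split i x y) Q (user i) ≡ (x + Q (user i)) ∸ h (user i)
      nextQueue-split false x y = refl
      nextQueue-split true  x y = refl

      nextQueue-split-not : ∀ i x y →
        nextQueue h (split i x y) Q (user (not i)) ≡ (y + Q (user (not i))) ∸ h (user (not i))
      nextQueue-split-not false x y = refl
      nextQueue-split-not true  x y = refl

      nextQueue-unused : ∀ i {x y} → NonNegative h → Unused Q → Unused (nextQueue h (split i x y) Q)
      nextQueue-unused i {x} {y} 0≤h unused j = antisym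
        (x∸y≤z ≤-refl (≤-respˡ-≈ (≈-sym (≈-trans (+-cong (zero-load i) (unused j)) (+-identityˡ 0#)))
          (≤-respʳ-≈ (≈-sym (+-identityˡ _)) (0≤h (suc (suc j))))))
        (0≤∸ _ _)
        where
        zero-load : ∀ i → split i x y (suc (suc j)) ≈ 0#
        zero-load false = ≈-refl
        zero-load true  = ≈-refl

      -- Each new queue is at least load plus queue minus allocation, strictly so when allocation is
      -- wasted; add this over the two users.
      backlog-nextQueue : ∀ i {x y} → x + y ≈ 8 · u →
        8 · u + backlog Q ≤ backlog (nextQueue h (split i x y) Q) + backlog h
      backlog-nextQueue i {x} {y} x+y≈8u = linear
        (x≤x∸y+y (L zero + Q zero) (h zero)
          ⊞ x≤x∸y+y (L (suc zero) + Q (suc zero)) (h (suc zero))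
          ⊞ ≤-reflexive (≈-trans (≈-sym x+y≈8u) (≈-sym (backlog-split i))))
        (solve 9 (λ L₀ L₁ Q₀ Q₁ Q₀′ Q₁′ h₀ h₁ v →
          ((Q₀′ :+ Q₁′) :+ (h₀ :+ h₁)) :+ ((L₀ :+ Q₀) :+ ((L₁ :+ Q₁) :+ v)) :=
          (v :+ (Q₀ :+ Q₁)) :+ ((Q₀′ :+ h₀) :+ ((Q₁′ :+ h₁) :+ (L₀ :+ L₁))))
          ≈-refl (L zero) (L (suc zero)) (Q zero) (Q (suc zero)) _ _ (h zero) (h (suc zero)) (8 · u))
        where
        L = split i x y
        backlog-split : ∀ i → backlog (split i x y) ≈ x + y
        backlog-split false = ≈-refl
        backlog-split true  = +-comm y x

    true-pattern : Subset (suc (suc k))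
    true-pattern = true ∷ true ∷ tabulate (λ _ → false)

    nonEmpty-pattern : ∀ {Q} → 0# < Q zero → 0# < Q (suc zero) → Unused Q → nonEmpty Q ≡ true-pattern
    nonEmpty-pattern {Q} 0<Q₀ 0<Q₁ unused = cong₂ _∷_ (dec-true (0# <? Q zero) 0<Q₀)
      (cong₂ _∷_ (dec-true (0# <? Q (suc zero)) 0<Q₁)
        (tabulate-cong λ i → dec-false (0# <? Q (suc (suc i))) λ 0<Qᵢ → <⇒≉ 0<Qᵢ (unused i)))

    at-each-user : ∀ {p} {P : Fin (suc (suc k)) → Set p} i → P (user i) → P (user (not i)) → ∀ j → P (user j)
    at-each-user false p q false = p
    at-each-user false p q true  = q
    at-each-user true  p q false = q
    at-each-user true  p q true  = p

    -- One step of the game against the algorithm.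

    module Game (𝒜 : OnlineAlgorithm (suc (suc k))) (target : Carrier) where
      open OnlineAlgorithm 𝒜

      -- A winning plan for `n` more steps, nested so that `play` can prepend a step. The history
      -- `A` is carried beside `Q` because it alone fixes the allocation, so plans for different
      -- queues can share one history.
      Forces : ∀ {t} → Vec (Subset (suc (suc k))) (suc t) → Users → ℕ → Set (a ⊔ˡ ℓ₂)
      Forces A Q zero    = Lift a (target ≤ backlog Q)
      Forces A Q (suc n) = Σ[ L ∈ Users ] Admissible L ×
        (let Q′ = nextQueue (allocate A) L Q in Forces (nonEmpty Q′ ∷ A) Q′ n)

      module _ {t} (A : Vec (Subset (suc (suc k))) (suc t)) where

        private
          h = allocate A

        h-nonNegative : NonNegative h
        h-nonNegative i = proj₁ (proj₁ (feasible A) i)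

        backlog-h : backlog h ≤ 8 · u
        backlog-h = ≤-respʳ-≈ (≈-sym 8·u≈1)
          (≤-trans (backlog≤sum h-nonNegative) (proj₂ (feasible A)))

        backlog-mono : ∀ Q i {x y} → x + y ≈ 8 · u → backlog Q ≤ backlog (nextQueue h (split i x y) Q)
        backlog-mono Q i x+y≈8u = linear (backlog-nextQueue h Q i x+y≈8u ⊞ backlog-h)
          (solve 4 (λ b b′ c v → b′ :+ ((v :+ b) :+ c) := b :+ ((b′ :+ c) :+ v)) ≈-refl
            (backlog Q) _ (backlog h) (8 · u))

        backlog-idle : ∀ Q i {x y} → x + y ≈ 8 · u → backlog h ≤ 7 · u →
          backlog Q + u ≤ backlog (nextQueue h (split i x y) Q)
        backlog-idle Q i x+y≈8u idle = linear (backlog-nextQueue h Q i x+y≈8u ⊞ idle)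
          (solve 4 (λ b b′ c u → b′ :+ ((8 :· u :+ b) :+ c) := (b :+ u) :+ ((b′ :+ c) :+ 7 :· u)) ≈-refl
            (backlog Q) _ (backlog h) u)

        -- The other user takes the whole load 1 and is allocated at most 1 - `h (user i)`, so its
        -- queue grows by at least `h (user i)`. User `i` loses at most `Q (user i)`, which is
        -- smaller by at least `u`.
        backlog-overserved : ∀ Q i → Q (user i) + u ≤ h (user i) →
          backlog Q + u ≤ backlog (nextQueue h (split i 0# (8 · u)) Q)
        backlog-overserved Q i over =
          ≤-respˡ-≈ (+-congʳ (backlog-user i Q)) (≤-respʳ-≈ (backlog-user i Q′) (linear
            (≤-trans (x≤x∸y+y (8 · u + Q (user (not i))) (h (user (not i))))
                (≤-reflexive (+-congʳ (≈-reflexive (sym (nextQueue-split-not h Q i 0# (8 · u))))))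
              ⊞ ≤-respˡ-≈ (≈-sym (backlog-user i h)) backlog-h
              ⊞ over
              ⊞ ≤-respʳ-≈ (≈-reflexive (sym (nextQueue-split h Q i 0# (8 · u)))) (0≤∸ _ _))
            (solve 8 (λ v o v′ o′ hᵢ hₒ e u →
              (v′ :+ o′) :+ ((e :+ o) :+ ((hᵢ :+ hₒ) :+ ((v :+ u) :+ con 0))) :=
              ((v :+ o) :+ u) :+ ((o′ :+ hₒ) :+ (e :+ (hᵢ :+ v′)))) ≈-refl
              (Q (user i)) (Q (user (not i))) _ _ (h (user i)) (h (user (not i))) (8 · u) u)))
          where Q′ = nextQueue h (split i 0# (8 · u)) Q

        -- Quantifying over `z` in `drained≤` bounds the drained queue by the maximum of `u` and
        -- `Q (user i) - h (user i)` without naming the maximum.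
        record Drained (i : Bool) (Q : Users) : Set (a ⊔ˡ ℓ₁ ⊔ˡ ℓ₂) where
          field
            {x y}    : Carrier
            0≤x      : 0# ≤ x
            0≤y      : 0# ≤ y
            x+y≈8u   : x + y ≈ 8 · u

          after = nextQueue h (split i x y) Q

          field
            u≤drained : u ≤ after (user i)
            drained≤  : ∀ z → u ≤ z → Q (user i) ≤ z + h (user i) → after (user i) ≤ z
            Q≤other   : Q (user (not i)) ≤ after (user (not i))

        -- The load of user i is the least one that leaves u in its queue.
        drain : ∀ i Q → u ≤ Q (user i) → h (user i) ≤ Q (user i) + u → Drained i Q
        drain i Q u≤v hᵢ≤v+u = record
          { 0≤x = 0≤∸ _ _
          ; 0≤y = proj₁ (proj₂ rest)
          ; x+y≈8u = ≈-sym (proj₂ (proj₂ rest))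
          ; u≤drained = ≤-respʳ-≈ (≈-reflexive (sym (nextQueue-split h Q i l r)))
              (+-cancelʳ-≤ (≤-trans (x≤x∸y+y (u + hᵢ) v) (x≤x∸y+y (l + v) hᵢ)))
          ; drained≤ = λ z u≤z v≤z+hᵢ → ≤-respˡ-≈ (≈-reflexive (sym (nextQueue-split h Q i l r)))
              (x∸y≤z (≤-trans 0≤u u≤z) (x∸y+y≤z (+-monoˡ-≤ hᵢ u≤z) v≤z+hᵢ))
          ; Q≤other = ≤-respʳ-≈ (≈-reflexive (sym (nextQueue-split-not h Q i l r)))
              (linear (x≤x∸y+y (r + o) hₒ ⊞ hₒ≤r)
                (solve 4 (λ o o′ hₒ r → o′ :+ ((r :+ o) :+ hₒ) := o :+ ((o′ :+ hₒ) :+ r)) ≈-refl o _ hₒ r))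
          }
          where
          v = Q (user i)
          o = Q (user (not i))
          hᵢ = h (user i)
          hₒ = h (user (not i))
          l = (u + hᵢ) ∸ v

          l≤hᵢ : l ≤ hᵢ
          l≤hᵢ = x∸y≤z (h-nonNegative (user i)) (≤-respˡ-≈ (+-comm hᵢ u) (+-monoʳ-≤ hᵢ u≤v))

          l≤2u : l ≤ 2 · u
          l≤2u = x∸y≤z (·u-nonNegative 2) (≤-respʳ-≈
            (solve 2 (λ u v → u :+ (v :+ u) := 2 :· u :+ v) ≈-refl u v) (+-monoʳ-≤ u hᵢ≤v+u))

          rest = difference (≤-trans l≤2u (·u-mono-≤ {2} {8} (s≤s (s≤s z≤n))))
          r = proj₁ rest

          -- Since `l` is at most `hᵢ`, the remaining load is at least 1 - `hᵢ`, which covers the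
          -- other user's allocation.
          hₒ≤r : hₒ ≤ r
          hₒ≤r = linear (l≤hᵢ ⊞ ≤-respˡ-≈ (≈-sym (backlog-user i h)) backlog-h ⊞ ≤-reflexive (proj₂ (proj₂ rest)))
            (solve 5 (λ l r hᵢ hₒ e → r :+ (l :+ ((hᵢ :+ hₒ) :+ e)) := hₒ :+ (hᵢ :+ (e :+ (l :+ r)))) ≈-refl
              l r hᵢ hₒ (8 · u))

        drained-mono : ∀ {i Q} → u ≤ Q (user i) → (d : Drained i Q) → Drained.after d (user i) ≤ Q (user i)
        drained-mono {i} {Q} u≤v d = Drained.drained≤ d (Q (user i)) u≤v (x≤x+y (h-nonNegative (user i)))

        -- An allocation of at least 3/8 that exceeds the queue by at most 1/8 means a queue of at
        -- least 2/8, so `Q (user i) - u` is a legitimate `z` for `drained≤`.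
        drained-strict : ∀ {i Q} → h (user i) ≤ Q (user i) + u → 3 · u ≤ h (user i) →
          (d : Drained i Q) → Drained.after d (user i) + u ≤ Q (user i)
        drained-strict {i} {Q} h≤v+u 3u≤h d = ≤-respʳ-≈ z+u≈v (+-monoˡ-≤ u
            (Drained.drained≤ d z (x≤x+y (proj₁ (proj₂ slack)))
              (≤-respˡ-≈ z+u≈v (+-monoʳ-≤ z (≤-trans (x≤x+y (·u-nonNegative 2)) 3u≤h)))))
          where
          v = Q (user i)
          slack = difference {u + u} {v} (linear (3u≤h ⊞ h≤v+u)
            (solve 3 (λ u v h → v :+ (3 :· u :+ h) := (u :+ u) :+ (h :+ (v :+ u))) ≈-refl u v (h (user i))))
          z = u + proj₁ slack
          z+u≈v : z + u ≈ v
          z+u≈v = ≈-trans (solve 2 (λ u s → (u :+ s) :+ u := (u :+ u) :+ s) ≈-refl u (proj₁ slack))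
            (≈-sym (proj₂ (proj₂ slack)))

        play : ∀ Q {n} i {x y} → 0# ≤ x → 0# ≤ y → x + y ≈ 8 · u →
          (let Q′ = nextQueue h (split i x y) Q in Forces (nonEmpty Q′ ∷ A) Q′ n) → Forces A Q (suc n)
        play Q i {x} {y} 0≤x 0≤y x+y≈8u f = split i x y , split-admissible i 0≤x 0≤y x+y≈8u , f

        drained-play : ∀ {i Q n} (d : Drained i Q) → Forces (nonEmpty (Drained.after d) ∷ A) (Drained.after d) n →
          Forces A Q (suc n)
        drained-play {i} {Q} d f = play Q i (Drained.0≤x d) (Drained.0≤y d) (Drained.x+y≈8u d) f

      -- Forcing the backlog to grow within a bounded time.

      hold : ∀ n {t} (A : Vec (Subset (suc (suc k))) (suc t)) {Q} → target ≤ backlog Q → Forces A Q n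
      hold zero    A p = lift p
      hold (suc n) A {Q} p = play A Q false ≤-refl (·u-nonNegative 8) (+-identityˡ _)
        (hold n _ (≤-trans p (backlog-mono A Q false (+-identityˡ _))))

      -- Stands for all later phases: it remains only to gain `u` over `B` with `R` steps to spare.
      Continuation : ℕ → Carrier → Set (a ⊔ˡ ℓ₁ ⊔ˡ ℓ₂)
      Continuation R B = ∀ {t} (A : Vec (Subset (suc (suc k))) (suc t)) {Q n} →
        NonNegative Q → Unused Q → R ℕ.≤ n → B + u ≤ backlog Q → Forces A Q n

      module _ {R B} (continue : Continuation R B)
               {t} (A : Vec (Subset (suc (suc k))) (suc t))
               {Q n} (unused : Unused Q) (R≤n : R ℕ.≤ n) (B≤Q : B ≤ backlog Q) where

        idle-forces : backlog (allocate A) ≤ 7 · u → Forces A Q (suc n)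
        idle-forces idle = play A Q false ≤-refl (·u-nonNegative 8) (+-identityˡ _)
          (continue _ (λ _ → 0≤∸ _ _) (nextQueue-unused _ Q false {0#} {8 · u} (h-nonNegative A) unused) R≤n
            (≤-trans (+-monoˡ-≤ u B≤Q) (backlog-idle A Q false (+-identityˡ _) idle)))

        overserved-forces : ∀ i → Q (user i) + u ≤ allocate A (user i) → Forces A Q (suc n)
        overserved-forces i over = play A Q i ≤-refl (·u-nonNegative 8) (+-identityˡ _)
          (continue _ (λ _ → 0≤∸ _ _) (nextQueue-unused _ Q i {0#} {8 · u} (h-nonNegative A) unused) R≤n
            (≤-trans (+-monoˡ-≤ u B≤Q) (backlog-overserved A Q i over)))

      -- The invariant of a race. `busy` asks for `u` rather than positivity because `drain` needs
      -- that much in the queue to keep its load within the allocation.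
      record Ready (B : Carrier) (Q : Users) : Set (ℓ₁ ⊔ˡ ℓ₂) where
        field
          unused : Unused Q
          busy   : ∀ i → u ≤ Q (user i)
          B≤     : B ≤ backlog Q

        nonEmpty≡ : nonEmpty Q ≡ true-pattern
        nonEmpty≡ = nonEmpty-pattern {Q} (<-≤-trans 0<u (busy false)) (<-≤-trans 0<u (busy true)) unused

      open Ready

      drained-ready : ∀ {t} (A : Vec (Subset (suc (suc k))) (suc t)) {i B Q} → Ready B Q →
        (d : Drained A i Q) → Ready B (Drained.after d)
      drained-ready A {i} {B} {Q} ready d = record
        { unused = nextQueue-unused _ Q i (h-nonNegative A) (unused ready)
        ; busy = at-each-user {P = λ j → u ≤ after j} i u≤drained (≤-trans (busy ready (not i)) Q≤other)
        ; B≤ = ≤-trans (B≤ ready) (backlog-mono A Q i x+y≈8u)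
        }
        where open Drained d

      -- Q i are the queues if user i is the one being drained.  The feedback is
      -- the same for both i, so the algorithm uses the same allocations.
      race : ∀ {R B} → Continuation R B → ∀ f {t} (A : Vec (Subset (suc (suc k))) (suc t)) (Q : Bool → Users) →
        (∀ i → Ready B (Q i)) → Q false (user false) + Q true (user true) ≤ f · u →
        ∀ {n} → f ℕ.+ R ℕ.≤ n → ∃ λ i → Forces A (Q i) n
      -- The countdown cannot reach 0, as each drained queue still holds `u`.
      race continue zero A Q ready sum≤0 _ = contradiction
        (antisym 0≤u (≤-trans (x≤x+y 0≤u) (≤-trans (busy (ready false) false ⊞ busy (ready true) true) sum≤0)))
        (proj₂ 0<u)
      race {R} {B} continue (suc f) A Q ready sum≤f {suc n} (s≤s f+R≤n) = result
        where
        R≤n = ℕₚ.m+n≤o⇒n≤o f f+R≤n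
        h = allocate A

        result : ∃ λ i → Forces A (Q i) (suc n)
        result with total (backlog h) (7 · u) | total (Q false (user false) + u) (h (user false))
                  | total (Q true (user true) + u) (h (user true))
        ... | inj₁ idle | _ | _ = false , idle-forces continue A (unused (ready false)) R≤n (B≤ (ready false)) idle
        ... | _ | inj₁ over | _ = false , overserved-forces continue A (unused (ready false)) R≤n (B≤ (ready false)) false over
        ... | _ | _ | inj₁ over = true , overserved-forces continue A (unused (ready true)) R≤n (B≤ (ready true)) true over
        -- Both plans go on under the feedback `true-pattern`. The recursion picks the plan that
        -- succeeds, and `nonEmpty≡` restores that plan's actual feedback.
        ... | inj₂ 7u≤h | inj₂ h₀≤ | inj₂ h₁≤ = proj₁ next , drained-play A (d (proj₁ next))
            (subst (λ E → Forces (E ∷ A) (after (proj₁ next)) n) (sym (nonEmpty≡ (ready′ (proj₁ next)))) (proj₂ next))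
          where
          h≤ : ∀ i → h (user i) ≤ Q i (user i) + u
          h≤ false = h₀≤
          h≤ true  = h₁≤

          d : ∀ i → Drained A i (Q i)
          d i = drain A i (Q i) (busy (ready i) i) (h≤ i)

          after : Bool → Users
          after i = Drained.after (d i)

          ready′ : ∀ i → Ready B (after i)
          ready′ i = drained-ready A (ready i) (d i)

          mono : ∀ i → after i (user i) ≤ Q i (user i)
          mono i = drained-mono A (busy (ready i) i) (d i)

          -- The two allocations total at least 7/8, so one is at least 3/8. The plan draining that
          -- user loses `u`; the queue drained in the other plan does not grow.
          sum′≤f : after false (user false) + after true (user true) ≤ f · u
          sum′≤f with total (3 · u) (h (user false))
          ... | inj₁ 3u≤h₀ = linear (drained-strict A h₀≤ 3u≤h₀ (d false) ⊞ mono true ⊞ sum≤f)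
            (solve 6 (λ v w v′ w′ u f → f :+ ((v′ :+ u) :+ (w′ :+ (v :+ w))) := (v′ :+ w′) :+ (v :+ (w :+ (u :+ f))))
              ≈-refl _ _ _ _ u (f · u))
          ... | inj₂ h₀≤3u = linear (mono false ⊞ drained-strict A h₁≤ 3u≤h₁ (d true) ⊞ sum≤f)
            (solve 6 (λ v w v′ w′ u f → f :+ (v′ :+ ((w′ :+ u) :+ (v :+ w))) := (v′ :+ w′) :+ (v :+ (w :+ (u :+ f))))
              ≈-refl _ _ _ _ u (f · u))
            where
            3u≤h₁ : 3 · u ≤ h (user true)
            3u≤h₁ = linear (h₀≤3u ⊞ 7u≤h ⊞ 0≤u)
              (solve 3 (λ h₀ h₁ u → h₁ :+ (h₀ :+ (7 :· u :+ con 0)) := 3 :· u :+ (3 :· u :+ ((h₀ :+ h₁) :+ u)))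
                ≈-refl (h (user false)) (h (user true)) u)

          next : ∃ λ i → Forces (true-pattern ∷ A) (after i) n
          next = race continue f (true-pattern ∷ A) after ready′ sum′≤f f+R≤n

      -- Unless the opening step already gains, loading 4/8 to each user leaves both queues at least
      -- `u`, with sum at most `(8 + m) · u`. The opening and a race of at most `8 + m` steps make
      -- `9 + m`.
      phase : ∀ m {R} {t} (A : Vec (Subset (suc (suc k))) (suc t)) {Q n} → Continuation R (backlog Q) →
        NonNegative Q → Unused Q → backlog Q ≤ m · u → 9 ℕ.+ m ℕ.+ R ℕ.≤ n → Forces A Q n
      phase m {R} A {Q} {suc n} continue 0≤Q unused Q≤m (s≤s R≤n) = result
        where
        h = allocate A
        Q′ = nextQueue h (split false (4 · u) (4 · u)) Q

        4u+4u≈8u : 4 · u + 4 · u ≈ 8 · u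
        4u+4u≈8u = ≈-sym (×-homo-+ u 4 4)

        result : Forces A Q (suc n)
        result with total (backlog h) (7 · u) | total (Q zero + u) (h zero)
                  | total (Q (suc zero) + u) (h (suc zero))
        ... | inj₁ idle | _ | _ = idle-forces continue A unused (ℕₚ.m+n≤o⇒n≤o (8 ℕ.+ m) R≤n) ≤-refl idle
        ... | _ | inj₁ over | _ = overserved-forces continue A unused (ℕₚ.m+n≤o⇒n≤o (8 ℕ.+ m) R≤n) ≤-refl false over
        ... | _ | _ | inj₁ over = overserved-forces continue A unused (ℕₚ.m+n≤o⇒n≤o (8 ℕ.+ m) R≤n) ≤-refl true over
        -- Both plans start from the same `Q′`, so either answer of `race` is a plan for `Q′`.
        ... | _ | inj₂ h₀≤ | inj₂ h₁≤ = play A Q false (·u-nonNegative 4) (·u-nonNegative 4) 4u+4u≈8u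
            (proj₂ (race continue (8 ℕ.+ m) (nonEmpty Q′ ∷ A) (λ _ → Q′) (λ _ → ready) sum≤ R≤n))
          where
          recharged : ∀ {h v} → h ≤ v + u → u ≤ (4 · u + v) ∸ h
          recharged {h} {v} h≤ = linear (x≤x∸y+y (4 · u + v) h ⊞ h≤ ⊞ ·u-nonNegative 2)
            (solve 4 (λ v v′ h u → v′ :+ ((4 :· u :+ v) :+ (h :+ con 0)) := u :+ ((v′ :+ h) :+ ((v :+ u) :+ 2 :· u)))
              ≈-refl v _ h u)

          recharged≤ : ∀ i → (4 · u + Q i) ∸ h i ≤ 4 · u + Q i
          recharged≤ i = x∸y≤z (+-nonNegative (·u-nonNegative 4) (0≤Q i)) (x≤x+y (h-nonNegative A i))

          ready : Ready (backlog Q) Q′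
          ready = record
            { unused = nextQueue-unused h Q false {4 · u} {4 · u} (h-nonNegative A) unused
            ; busy   = at-each-user {P = λ j → u ≤ Q′ j} false (recharged h₀≤) (recharged h₁≤)
            ; B≤     = backlog-mono A Q false 4u+4u≈8u
            }

          sum≤ : Q′ zero + Q′ (suc zero) ≤ (8 ℕ.+ m) · u
          sum≤ = ≤-respʳ-≈ (≈-sym (×-homo-+ u 8 m))
            (linear (recharged≤ zero ⊞ recharged≤ (suc zero) ⊞ Q≤m)
              (solve 6 (λ v w v′ w′ u m →
                (8 :· u :+ m) :+ (v′ :+ (w′ :+ (v :+ w))) := (v′ :+ w′) :+ ((4 :· u :+ v) :+ ((4 :· u :+ w) :+ m)))
                ≈-refl (Q zero) (Q (suc zero)) _ _ u (m · u)))

    -- Repeated phases and the resulting load sequence.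

    module _ (𝒜 : OnlineAlgorithm (suc (suc k))) (m : ℕ) where
      open Game 𝒜 (m · u)

      -- `j` counts gains made, `r` phases left. Until the target is met the backlog is at most
      -- `m · u`, so every phase fits in `9 + m` steps.
      forces : ∀ r j → j ℕ.+ r ≡ m → ∀ {t} (A : Vec (Subset (suc (suc k))) (suc t)) {Q n} →
        NonNegative Q → Unused Q → j · u ≤ backlog Q → r ℕ.* (9 ℕ.+ m) ℕ.≤ n → Forces A Q n
      forces zero j eq A {Q} 0≤Q unused j≤Q _ = hold _ A {Q} (subst (λ i → i · u ≤ backlog Q) eq′ j≤Q)
        where eq′ = ≡-trans (sym (ℕₚ.+-identityʳ j)) eq
      forces (suc r) j eq A {Q} 0≤Q unused j≤Q r≤n with total (m · u) (backlog Q)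
      ... | inj₁ m≤Q = hold _ A {Q} m≤Q
      ... | inj₂ Q≤m = phase m A
        (λ A′ 0≤Q′ unused′ r≤n′ gain → forces r (suc j) (≡-trans (sym (ℕₚ.+-suc j r)) eq) A′ 0≤Q′ unused′
          (≤-trans (≤-respˡ-≈ (+-comm (j · u) u) (+-monoˡ-≤ u j≤Q)) gain) r≤n′)
        0≤Q unused Q≤m r≤n

      loads : ∀ n {t} {A : Vec (Subset (suc (suc k))) (suc t)} {Q} → Forces A Q n → ℕ → Users
      loads zero    _           _       = λ _ → 0#
      loads (suc n) (L , _)     zero    = L
      loads (suc n) (_ , _ , f) (suc s) = loads n f s

      loads-admissible : ∀ n {t} {A : Vec (Subset (suc (suc k))) (suc t)} {Q} (f : Forces A Q n) →
        ∀ s → Admissible (loads n f s)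
      loads-admissible zero    _           _       = (λ _ → ≤-refl)
        , ≤-respˡ-≈ (≈-sym (MonoidSum.sum-replicate-zero +-monoid (suc (suc k)))) 0≤1
      loads-admissible (suc n) (_ , p , _) zero    = p
      loads-admissible (suc n) (_ , _ , f) (suc s) = loads-admissible n f s

      open Run using (runQueue; feedback)

      -- The plan was built against the algorithm's own allocations: once the load at `t` is
      -- identified with the plan's, the plan's next state is by definition the run's state at
      -- `suc t`.
      loads-force : ∀ L n t (f : Forces (feedback 𝒜 L t) (runQueue 𝒜 L t) n) →
        (∀ s → L (t ℕ.+ s) ≡ loads n f s) → m · u ≤ backlog (runQueue 𝒜 L (t ℕ.+ n))
      loads-force L zero t (lift p) eq = subst (λ s → m · u ≤ backlog (runQueue 𝒜 L s)) (sym (ℕₚ.+-identityʳ t)) p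
      loads-force L (suc n) t (l , q , f) eq
        with refl ← subst (λ s → L s ≡ l) (ℕₚ.+-identityʳ t) (eq 0) =
        subst (λ s → m · u ≤ backlog (runQueue 𝒜 L s)) (sym (ℕₚ.+-suc t n))
          (loads-force L n (suc t) f λ s → subst (λ i → L i ≡ loads n f s) (ℕₚ.+-suc t s) (eq (suc s)))

  -- Conservation of work and the offline optimum.

  sum-toℕ-suc : ∀ T (x : ℕ → Carrier) → sum {suc T} (x ∘ toℕ) ≈ sum {T} (x ∘ toℕ) + x T
  sum-toℕ-suc zero    x = +-comm (x 0) 0#
  sum-toℕ-suc (suc T) x = ≈-trans (+-congˡ (sum-toℕ-suc T (x ∘ suc))) (≈-sym (+-assoc (x 0) _ _))

  element≤sum : ∀ {n} {x : Vector Carrier n} → (∀ i → 0# ≤ x i) → ∀ i → x i ≤ sum x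
  element≤sum 0≤x zero    = x≤x+y (sum-nonNegative (0≤x ∘ suc))
  element≤sum 0≤x (suc i) = ≤-trans (element≤sum (0≤x ∘ suc) i)
    (≤-respʳ-≈ (+-comm _ _) (x≤x+y (0≤x zero)))

  module _ {N : ℕ} (L : ℕ → Vector Carrier N) where

    totalLoad : ℕ → Carrier
    totalLoad T = sum {T} λ t → sum (L (toℕ t))

    queue-nonNegative : ∀ h t i → 0# ≤ queue h L t i
    queue-nonNegative h zero    i = ≤-refl
    queue-nonNegative h (suc t) i = 0≤∸ _ _

    balance : ∀ h T → totalWork T h L + sum (queue h L T) ≈ totalLoad T
    balance h zero    = ≈-trans (+-identityˡ _) (MonoidSum.sum-replicate-zero +-monoid N)
    balance h (suc T) = ≈-trans (+-congʳ (sum-toℕ-suc T λ t → sum (work h L t)))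
      (≈-trans (+-assoc W w q′)
      (≈-trans (+-congˡ step)
      (≈-trans (solve 3 (λ W l q → W :+ (l :+ q) := (W :+ q) :+ l) ≈-refl W l q)
      (≈-trans (+-congʳ (balance h T)) (≈-sym (sum-toℕ-suc T λ t → sum (L t)))))))
      where
      open CommutativeMonoidSum +-commutativeMonoid using (∑-distrib-+; sum-cong-≋)
      W  = totalWork T h L
      w  = sum (work h L T)
      q′ = sum (queue h L (suc T))
      l  = sum (L T)
      q  = sum (queue h L T)
      step : w + q′ ≈ l + q
      step = ≈-trans (≈-sym (∑-distrib-+ (work h L T) (queue h L (suc T))))
        (≈-trans (sum-cong-≋ λ i → ⊓+∸ (h T i) (L T i + queue h L T i))
          (∑-distrib-+ (L T) (queue h L T)))

    queue-self : ∀ t i → queue L L t i ≈ 0#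
    queue-self zero    i = ≈-refl
    queue-self (suc t) i = antisym (x∸y≤z ≤-refl (≤-reflexive
      (≈-trans (+-congˡ (queue-self t i)) (+-comm _ 0#)))) (0≤∸ _ _)

    totalWork-self : ∀ T → totalWork T L L ≈ totalLoad T
    totalWork-self T = ≈-trans (≈-sym (+-identityʳ _)) (≈-trans
      (+-congˡ (≈-sym (≈-trans (MonoidSum.sum-cong-≋ +-monoid (queue-self T)) (MonoidSum.sum-replicate-zero +-monoid N))))
      (balance L T))

    -- By `balance` no schedule does more work than the total load, and `L` used as allocation
    -- attains it.
    self-optimal : (∀ t → NonNegative (L t) × sum (L t) ≤ 1#) → ∀ T → IsOptimalOffline T L L
    self-optimal admissible T
      = (λ t _ → let 0≤L , L≤1 = admissible t in
           (λ i → 0≤L i , ≤-trans (element≤sum 0≤L i) L≤1) , L≤1)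
      , (λ h _ → ≤-respʳ-≈ (≈-trans (balance h T) (≈-sym (totalWork-self T)))
           (x≤x+y (sum-nonNegative (queue-nonNegative h T))))

    -- In fact an equality: `L` serves the total load, `h` that load minus its final queues.
    regret : ∀ h T → sum (queue h L T) ≤ totalWork T L L - totalWork T h L
    regret h T = +-cancelʳ-≤ (≤-reflexive (≈-trans (+-comm _ _) (≈-trans (balance h T)
      (≈-trans (≈-sym (totalWork-self T)) (≈-sym (x-y+y≈x _ _))))))

  -- The constant and the number of phases.

  u²√≤m·u : ∀ {T m} → T ℕ.≤ 8 ℕ.* m ℕ.* (8 ℕ.* m) → u * u * √ℕ T ≤ m · u
  u²√≤m·u {T} {m} T≤ = ≤-respˡ-≈ (*-comm (√ℕ T) (u * u)) (≤-respʳ-≈ scale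
    (*-monoʳ-≤ (*-nonNegative 0≤u 0≤u)
      (square-cancel-≤ (fromℕ-nonNegative (8 ℕ.* m))
        (≤-respˡ-≈ (≈-sym (√-square (fromℕ-nonNegative T)))
          (≤-respʳ-≈ (×1-homo-* (8 ℕ.* m) (8 ℕ.* m)) (fromℕ-mono-≤ T≤))))))
    where
    -- One factor `u` cancels the 8 in the bound 8m on `√ℕ T`; the other gives `m · u`.
    scale : fromℕ (8 ℕ.* m) * (u * u) ≈ m · u
    scale = ≈-trans (*-congʳ (×1-homo-* 8 m))
      (≈-trans (solve 3 (λ e n u → (e :* n) :* (u :* u) := (e :* u) :* (n :* u)) ≈-refl (fromℕ 8) (fromℕ m) u)
      (≈-trans (*-cong (≈-trans (fromℕ-* 8 u) 8·u≈1) (fromℕ-* m u)) (*-identityˡ (m · u))))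

-- For the horizon `n + 10`, `suc m` phases of `9 + suc m` steps must fit, with `suc m` still of
-- square-root order. As `n` grows, `m` is raised when one more phase count fits; otherwise the
-- failure to fit bounds the horizon.
phases : ∀ n → Σ[ m ∈ ℕ ] suc m ℕ.* (10 ℕ.+ m) ℕ.≤ n ℕ.+ 10 × n ℕ.+ 10 ℕ.≤ 8 ℕ.* suc m ℕ.* (8 ℕ.* suc m)
phases zero = 0 , ℕₚ.≤-refl , ℕₚ.m≤m+n 10 54
phases (suc n) with phases n
... | m , m≤ , ≤m with suc (suc m) ℕ.* (11 ℕ.+ m) ℕₚ.≤? suc n ℕ.+ 10
...   | yes p = suc m , p , ℕₚ.≤-trans (s≤s ≤m) (ℕₚ.≤-trans (ℕₚ.m≤m+n _ (191 ℕ.+ 128 ℕ.* m))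
          (ℕₚ.≤-reflexive (solve 1 (λ m → con 1 :+ con 8 :* (con 1 :+ m) :* (con 8 :* (con 1 :+ m)) :+ (con 191 :+ con 128 :* m)
             := con 8 :* (con 2 :+ m) :* (con 8 :* (con 2 :+ m))) refl m)))
  where open +-*-Solver
...   | no ¬p = m , ℕₚ.≤-trans m≤ (ℕₚ.n≤1+n _) , ℕₚ.≤-trans (ℕₚ.<⇒≤ (ℕₚ.≰⇒> ¬p))
          (ℕₚ.≤-trans (ℕₚ.m≤m+n _ (42 ℕ.+ 115 ℕ.* m ℕ.+ 63 ℕ.* (m ℕ.* m)))
          (ℕₚ.≤-reflexive (solve 1 (λ m → (con 2 :+ m) :* (con 11 :+ m) :+ (con 42 :+ con 115 :* m :+ con 63 :* (m :* m))
             := con 8 :* (con 1 :+ m) :* (con 8 :* (con 1 :+ m))) refl m)))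
  where open +-*-Solver

theorem2 : ∀ {a ℓ₁ ℓ₂} (ℝ : CompleteOrderedField a ℓ₁ ℓ₂) →
    let open SharedResource ℝ in
    Σ[ c ∈ Carrier ] 0# < c × Σ[ T₀ ∈ ℕ ]
    (∀ (N T : ℕ) → 2 ℕ.≤ N → T₀ ℕ.≤ T → (𝒜 : OnlineAlgorithm N) →
    Σ[ L ∈ (ℕ → Vector Carrier N) ] (∀ t → NonNegative (L t)) ×
    Σ[ h* ∈ (ℕ → Vector Carrier N) ] IsOptimalOffline T L h* ×
    c * √ℕ T ≤ totalWork T h* L - totalWork T (allocations 𝒜 L) L)
-- A single phase with target `1 · u` takes 10 steps, hence the threshold.
theorem2 ℝ = u * u , 0<u*u , 10 , adversary
  where
  open SharedResource ℝ
  open SquareRoot ℝ using (square-cancel-≤)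
  open Adversary ℝ

  0<u*u : 0# < u * u
  0<u*u = *-nonNegative 0≤u 0≤u , λ 0≈uu → proj₂ 0<u (antisym 0≤u
    (square-cancel-≤ ≤-refl (≤-reflexive (≈-trans (≈-sym 0≈uu) (≈-sym (zeroˡ 0#))))))

  adversary : ∀ (N T : ℕ) → 2 ℕ.≤ N → 10 ℕ.≤ T → (𝒜 : OnlineAlgorithm N) →
    Σ[ L ∈ (ℕ → Vector Carrier N) ] (∀ t → NonNegative (L t)) ×
    Σ[ h* ∈ (ℕ → Vector Carrier N) ] IsOptimalOffline T L h* ×
    u * u * √ℕ T ≤ totalWork T h* L - totalWork T (allocations 𝒜 L) L
  adversary (suc (suc k)) T (s≤s (s≤s z≤n)) 10≤T 𝒜 =
    L , (λ t → proj₁ (admissible t)) , L , self-optimal L admissible T ,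
    ≤-trans (u²√≤m·u {T} {suc m} T≤)
      (≤-trans (loads-force 𝒜 (suc m) L T 0 strategy (λ _ → refl))
      (≤-trans (subst (λ Q → backlog Q ≤ sum (queue h L T)) (sym (Run.runQueue≡queue 𝒜 L T))
        (backlog≤sum (queue-nonNegative L h T)))
      (regret L h T)))
    where
    split-time : Σ[ m ∈ ℕ ] suc m ℕ.* (10 ℕ.+ m) ℕ.≤ T × T ℕ.≤ 8 ℕ.* suc m ℕ.* (8 ℕ.* suc m)
    split-time = subst (λ T → Σ[ m ∈ ℕ ] suc m ℕ.* (10 ℕ.+ m) ℕ.≤ T × T ℕ.≤ 8 ℕ.* suc m ℕ.* (8 ℕ.* suc m))
      (ℕₚ.m∸n+n≡m 10≤T) (phases (T ℕ.∸ 10))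
    m = proj₁ split-time
    T≤ = proj₂ (proj₂ split-time)
    -- The initial history is `feedback 𝒜 L 0` for every `L`, so the plan can be made before `L` is
    -- read off from it.
    strategy = forces 𝒜 (suc m) (suc m) 0 refl (nonEmpty (λ _ → 0#) ∷ []) {λ _ → 0#} {T} (λ _ → ≤-refl) (λ _ → ≈-refl)
      (≤-reflexive (≈-sym (+-identityˡ 0#))) (proj₁ (proj₂ split-time))
    L = loads 𝒜 (suc m) T strategy
    admissible = loads-admissible 𝒜 (suc m) T strategy
    h = allocations 𝒜 L
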